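{- For every integer $n\geq 0$, $$B_{n}(y,t)=\sum_{k=0}^{n}\binom{n}{k}(1+y)^{k}(1-t)^{n-k}A_{k}(t).$$
   Context: $\mathfrak{S}_n$ is the set of permutations $\pi=\pi_1\cdots\pi_n$ of $[n]=\{1,\dots,n\}$, $\mathrm{des}(\pi)$ is the number of $i\in[n-1]$ with $\pi_i>\pi_{i+1}$, and the Eulerian polynomials are $A_n(t)=\sum_{\pi\in\mathfrak{S}_n}t^{\mathrm{des}(\pi)+1}$ for $n\ge1$ and $A_0(t)=1$. $\mathfrak{B}_n$ is the set of signed permutations: permutations $\pi$ of $\{ -n,\dots,-1,0,1,\dots,n\}$ with $\pi_{ -i}=-\pi_i$ for all $i$ (so $\pi_0=0$), written $\pi=\pi_1\cdots\pi_n$. For $\pi\in\mathfrak{B}_n$, $\mathrm{des}_B(\pi)$ is the number of $i\in\{0,1,\dots,n-1\}$ with $\pi_i>\pi_{i+1}$ (where $\pi_0=0$), and $\mathrm{neg}(\pi)$ is the number of $i\in[n]$ with $\pi_i<0$. $B_n(y,t)=\sum_{\pi\in\mathfrak{B}_n}y^{\mathrm{neg}(\pi)}t^{\mathrm{des}_B(\pi)}$ for $n\ge1$, and $B_0(y,t)=1$. -}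

module Defs where

open import Algebra.Bundles using (CommutativeRing)
open import Data.Fin.Base using (Fin; zero; suc; inject₁; opposite; _↑ʳ_)
open import Data.Fin.Properties using (_≟_; _<?_; all?; any?)
open import Data.List.Base using (List; []; _∷_; cartesianProductWith; filter; foldr; map)
import Data.List.Base as List
open import Data.Nat.Base as ℕ using (ℕ; zero; suc)
open import Data.Product.Base using (_×_)
open import Data.Vec.Base as Vec using (Vec; []; _∷_; lookup; count)
open import Function.Base using (_∘_)
open import Function.Consequences.Propositional
  using (strictlySurjective⇒surjective; surjective⇒strictlySurjective)
open import Function.Definitions using (Injective; Surjective; Bijective)
open import Relation.Binary.PropositionalEquality.Core using (_≡_)
open import Relation.Nullary.Decidable using (Dec; map′; _×-dec_; _→-dec_)

-- All words of length n over Fin m, each exactly once.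
words : ∀ m n → List (Vec (Fin m) n)
words m zero    = [] ∷ []
words m (suc n) = cartesianProductWith _∷_ (List.allFin m) (words m n)

IsPermutation : ∀ {n} → Vec (Fin n) n → Set
IsPermutation π = Bijective _≡_ _≡_ (lookup π)

isPermutation? : ∀ {n} (π : Vec (Fin n) n) → Dec (IsPermutation π)
isPermutation? π = injective? ×-dec surjective?
  where
  injective? : Dec (Injective _≡_ _≡_ (lookup π))
  injective? = map′ (λ inj {i} {j} → inj i j) (λ inj i j → inj)
    (all? λ i → all? λ j → (lookup π i ≟ lookup π j) →-dec (i ≟ j))

  surjective? : Dec (Surjective _≡_ _≡_ (lookup π))
  surjective? = map′ strictlySurjective⇒surjective surjective⇒strictlySurjective
    (all? λ j → any? λ i → lookup π i ≟ j)

-- Fin n stands for [n], the element i representing toℕ i + 1; this shift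
-- preserves the order, hence descents.
𝔖 : ∀ n → List (Vec (Fin n) n)
𝔖 n = filter isPermutation? (words n n)

-- The number of descents of w₀ w₁ ⋯ wₙ.
des : ∀ {m n} → (Fin (suc n) → Fin m) → ℕ
des {n = n} w = count (λ i → w (suc i) <? w (inject₁ i)) (Vec.allFin n)

-- ± n stands for {-n,…,n}, the element i representing toℕ i - n.  The order
-- is that of the integers, negation is `opposite`, and `nonNeg` embeds
-- {0,…,n}.
± : ℕ → Set
± n = Fin (n ℕ.+ suc n)

nonNeg : ∀ {n} → Fin (suc n) → ± n
nonNeg {n} i = n ↑ʳ i

IsSignedPermutation : ∀ {n} → Vec (± n) (n ℕ.+ suc n) → Set
IsSignedPermutation π =
  IsPermutation π × (∀ i → lookup π (opposite i) ≡ opposite (lookup π i))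

isSignedPermutation? : ∀ {n} (π : Vec (± n) (n ℕ.+ suc n)) → Dec (IsSignedPermutation π)
isSignedPermutation? π =
  isPermutation? π ×-dec all? (λ i → lookup π (opposite i) ≟ opposite (lookup π i))

-- Each π is listed with all of its values π₋ₙ ⋯ π₀ ⋯ πₙ.
𝔅 : ∀ n → List (Vec (± n) (n ℕ.+ suc n))
𝔅 n = filter isSignedPermutation? (words (n ℕ.+ suc n) (n ℕ.+ suc n))

desB : ∀ {n} → Vec (± n) (n ℕ.+ suc n) → ℕ
desB {n} π = des (λ i → lookup π (nonNeg {n} i))

neg : ∀ {n} → Vec (± n) (n ℕ.+ suc n) → ℕ
neg {n} π = count (λ i → lookup π (nonNeg {n} (suc i)) <? nonNeg {n} zero) (Vec.allFin n)

-- Polynomials with integer coefficients are rendered by their values at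
-- arbitrary elements of an arbitrary commutative ring; the formal polynomials
-- are the values at the indeterminates of ℤ[y,t].
module EulerianPolynomials {a ℓ} (R : CommutativeRing a ℓ) where

  open CommutativeRing R using (Carrier; _+_; _*_; 0#; 1#; semiring)
  open import Algebra.Properties.Semiring.Exp semiring using (_^_)

  sumOver : ∀ {b} {X : Set b} → List X → (X → Carrier) → Carrier
  sumOver xs f = foldr _+_ 0# (map f xs)

  A : ℕ → Carrier → Carrier
  A zero    t = 1#
  A (suc n) t = sumOver (𝔖 (suc n)) λ π → t ^ (des (lookup π) ℕ.+ 1)

  B : ℕ → Carrier → Carrier → Carrier
  B zero      y t = 1#
  B n@(suc _) y t = sumOver (𝔅 n) λ π → (y ^ neg {n} π) * (t ^ desB {n} π)

{-# OPTIONS --safe #-}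
module Submission where

-- A signed permutation is a permutation τ together with a sign for each
-- letter, and its descents are those of the word 0 w, where w is τ read in the
-- signed letters.  Standardizing w turns 0 into a threshold: for fixed signs
-- with q minus signs, the sum over τ is
--   Q n q = Σ_{σ ∈ 𝔖 n} t ^ des (q σ),
-- where a first letter below q counts as a descent.  In particular Q n n = Aₙ(t).
-- Raising the threshold from c to c + 1 matters only to the σ that start with
-- the letter c, which then acts as the threshold for the rest of σ; hence
--   Q (n+1) c = Q (n+1) (c+1) + (1 - t) Q n c.
-- Summed over all signs, this recurrence becomes Pascal's rule for the binomial
-- sum on the right-hand side.

open import Defs
open import Algebra.Bundles using (CommutativeRing)
open import Algebra.Properties.CommutativeMonoid.Sum using ()
open import Algebra.Properties.Semiring.Exp using ()
open import Algebra.Properties.Semiring.Mult using ()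
open import Algebra.Properties.Semiring.Sum using ()
open import Data.Bool.Base using (true; false; if_then_else_)
open import Data.Fin.Base as Fin using (Fin; zero; suc; toℕ; fromℕ<; inject₁; opposite; punchIn; punchOut; splitAt; _↑ˡ_)
open import Data.Fin.Permutation using (Permutation′; permutation)
open import Data.Fin.Properties
  using (toℕ-injective; toℕ<n; toℕ-fromℕ; toℕ-fromℕ<; toℕ-inject₁; toℕ-↑ˡ; toℕ-↑ʳ; ↑ʳ-injective; suc-injective;
         opposite-prop; opposite-involutive; punchIn-injective; punchIn-mono-≤; punchIn-cancel-≤;
         punchIn-punchOut; punchOut-injective; punchInᵢ≢i; injective⇒≤; splitAt-↑ˡ; splitAt-↑ʳ;
         splitAt⁻¹-↑ˡ; splitAt⁻¹-↑ʳ; any?)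
  renaming (_≟_ to _≟ᶠ_; _<?_ to _<ᶠ?_)
open import Data.List.Base as List using (List; []; _∷_; cartesianProduct; cartesianProductWith)
open import Data.List.Membership.Propositional using (_∈_)
open import Data.List.Membership.Propositional.Properties
  using (∈-map⁺; ∈-map⁻; ∈-allFin; ∈-filter⁺; ∈-filter⁻; ∈-cartesianProductWith⁺; ∈-cartesianProduct⁺; ∈-cartesianProduct⁻)
open import Data.List.Membership.Propositional.Properties.WithK using (unique∧set⇒bag)
open import Data.List.Relation.Binary.BagAndSetEquality using (∼bag⇒↭)
open import Data.List.Relation.Binary.Permutation.Propositional using (_↭_; ↭⇒↭ₛ′)
open import Data.List.Relation.Binary.Permutation.Propositional.Properties using () renaming (map⁺ to ↭-map⁺)
open import Data.List.Relation.Binary.Permutation.Setoid.Properties using (foldr-commMonoid)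
import Data.List.Relation.Unary.All as All
import Data.List.Relation.Unary.All.Properties as All
open import Data.List.Relation.Unary.AllPairs using ([]; _∷_)
open import Data.List.Relation.Unary.Any using (here; there)
open import Data.List.Relation.Unary.Unique.Propositional using (Unique)
import Data.List.Relation.Unary.Unique.Propositional.Properties as Unique
open import Data.Nat.Base as ℕ using (ℕ; zero; suc; _∸_; _≤_; _<_; z≤n; s≤s)
open import Data.Nat.Combinatorics using (_C_; nCk+nC[k+1]≡[n+1]C[k+1]; k>n⇒nCk≡0)
import Data.Nat.Properties as ℕ
open import Data.Product.Base using (_,_; proj₁; proj₂; ∃; uncurry) renaming (_×_ to _∧_)
open import Data.Sum.Base using (inj₁; inj₂)
open import Data.Vec.Base as Vec using (Vec; []; _∷_; lookup; tabulate; count)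
open import Data.Vec.Properties using (lookup∘tabulate; tabulate∘lookup; tabulate-cong; lookup-map; ∷-injective)
open import Function.Base using (_∘_; id)
open import Function.Bundles using (_⇔_; mk⇔; Equivalence)
open import Function.Consequences.Propositional
  using (strictlySurjective⇒surjective; surjective⇒strictlySurjective)
open import Function.Definitions using (Injective)
open import Relation.Binary.PropositionalEquality
  using (_≡_; _≢_; refl; sym; trans; cong; cong₂; subst; subst₂; _≗_; module ≡-Reasoning)
open import Relation.Nullary using (¬_; Dec; yes; no; does; contradiction)
open import Relation.Nullary.Decidable using (does-⇔)

open Algebra.Properties.CommutativeMonoid.Sum ℕ.+-0-commutativeMonoid
  using (sum; sum-cong-≗; sum-permute)

-- Finite injections and permutations.

lookup-injective : ∀ {A : Set} {n} {xs ys : Vec A n} → lookup xs ≗ lookup ys → xs ≡ ys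
lookup-injective {xs = xs} {ys} eq =
  trans (sym (tabulate∘lookup xs)) (trans (tabulate-cong eq) (tabulate∘lookup ys))

-- If `j` were missed, punching it out of the codomain would turn `f` into an injection from `n + 1`
-- elements into `n`.
injective⇒hits : ∀ {n} {f : Fin n → Fin n} → Injective _≡_ _≡_ f → ∀ j → ∃ λ i → f i ≡ j
injective⇒hits {suc n} {f} inj j with any? (λ i → f i ≟ᶠ j)
... | yes hit  = hit
... | no  miss = contradiction (injective⇒≤ {f = λ i → punchOut {i = j} (j≢f i)} punched) ℕ.1+n≰n
  where
  j≢f : ∀ i → j ≢ f i
  j≢f i eq = miss (i , sym eq)
  punched : Injective _≡_ _≡_ (λ i → punchOut {i = j} (j≢f i))
  punched {i} {k} eq = inj (punchOut-injective (j≢f i) (j≢f k) eq)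

injective⇒isPermutation : ∀ {n} (π : Vec (Fin n) n) → Injective _≡_ _≡_ (lookup π) → IsPermutation π
injective⇒isPermutation π inj = inj , strictlySurjective⇒surjective (injective⇒hits inj)

module Inverse {n} (τ : Vec (Fin n) n) (perm : IsPermutation τ) where

  private
    hits : ∀ a → ∃ λ i → lookup τ i ≡ a
    hits = surjective⇒strictlySurjective (proj₂ perm)

  position : Fin n → Fin n
  position a = proj₁ (hits a)

  lookup-position : ∀ a → lookup τ (position a) ≡ a
  lookup-position a = proj₂ (hits a)

  position-lookup : ∀ i → position (lookup τ i) ≡ i
  position-lookup i = proj₁ perm (lookup-position (lookup τ i))

  toPermutation : Permutation′ n
  toPermutation = permutation (lookup τ) position lookup-position position-lookup

-- Indicators and finite sums of natural numbers.

𝟙 : ∀ {P : Set} → Dec P → ℕ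
𝟙 P? = if does P? then 1 else 0

𝟙-⇔ : ∀ {P Q : Set} (P? : Dec P) (Q? : Dec Q) → P ⇔ Q → 𝟙 P? ≡ 𝟙 Q?
𝟙-⇔ P? Q? P⇔Q = cong (if_then 1 else 0) (does-⇔ P⇔Q P? Q?)

𝟙-yes : ∀ {P : Set} (P? : Dec P) → P → 𝟙 P? ≡ 1
𝟙-yes (yes _) _ = refl
𝟙-yes (no ¬p) p = contradiction p ¬p

𝟙-no : ∀ {P : Set} (P? : Dec P) → ¬ P → 𝟙 P? ≡ 0
𝟙-no (yes p) ¬p = contradiction p ¬p
𝟙-no (no _)  _  = refl

𝟙-mono : ∀ {P Q : Set} (P? : Dec P) (Q? : Dec Q) → (P → Q) → 𝟙 P? ≤ 𝟙 Q?
𝟙-mono (no _)  _       _ = z≤n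
𝟙-mono (yes p) (yes _) _ = ℕ.≤-refl
𝟙-mono (yes p) (no ¬q) f = contradiction (f p) ¬q

𝟙≤1 : ∀ {P : Set} (P? : Dec P) → 𝟙 P? ≤ 1
𝟙≤1 (yes _) = ℕ.≤-refl
𝟙≤1 (no _)  = z≤n

count-tabulate : ∀ {A : Set} {P : A → Set} (P? : ∀ a → Dec (P a)) {n} (f : Fin n → A) →
                 count P? (tabulate f) ≡ sum (λ i → 𝟙 (P? (f i)))
count-tabulate P? {zero}  f = refl
count-tabulate P? {suc n} f with does (P? (f zero))
... | true  = cong suc (count-tabulate P? (f ∘ suc))
... | false = count-tabulate P? (f ∘ suc)

sum-mono-≤ : ∀ {n} {f g : Fin n → ℕ} → (∀ i → f i ≤ g i) → sum f ≤ sum g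
sum-mono-≤ {zero}  f≤g = z≤n
sum-mono-≤ {suc n} f≤g = ℕ.+-mono-≤ (f≤g zero) (sum-mono-≤ (f≤g ∘ suc))

sum-mono-< : ∀ {n} {f g : Fin n → ℕ} → (∀ i → f i ≤ g i) → ∀ i → f i < g i → sum f < sum g
sum-mono-< f≤g zero    f<g = ℕ.+-mono-<-≤ f<g (sum-mono-≤ (f≤g ∘ suc))
sum-mono-< f≤g (suc i) f<g = ℕ.+-mono-≤-< (f≤g zero) (sum-mono-< (f≤g ∘ suc) i f<g)

sum-ones : ∀ n → sum {n} (λ _ → 1) ≡ n
sum-ones zero    = refl
sum-ones (suc n) = cong suc (sum-ones n)

-- Descents relative to a threshold.

-- The descents of the word `c w₀ w₁ ⋯`. Letters are natural numbers so that the threshold `c` may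
-- lie above all of them.
desFrom : ∀ {n} → ℕ → (Fin n → ℕ) → ℕ
desFrom {zero}  c w = 0
desFrom {suc n} c w = 𝟙 (w zero ℕ.<? c) ℕ.+ desFrom (w zero) (w ∘ suc)

-- Only the outcomes of comparisons enter the count. After one step the first letter is the new
-- threshold, so `order` takes over the role of `cut`.
desFrom-⇔ : ∀ {n c c′} {w w′ : Fin n → ℕ} →
            (∀ i → w i < c ⇔ w′ i < c′) → (∀ i j → w i < w j ⇔ w′ i < w′ j) →
            desFrom c w ≡ desFrom c′ w′
desFrom-⇔ {zero}  cut order = refl
desFrom-⇔ {suc n} {c} {c′} {w} {w′} cut order =
  cong₂ ℕ._+_ (𝟙-⇔ (w zero ℕ.<? c) (w′ zero ℕ.<? c′) (cut zero))
    (desFrom-⇔ (λ i → order (suc i) zero) (λ i j → order (suc i) (suc j)))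

desFrom-cong : ∀ {n c c′} {w w′ : Fin n → ℕ} → c ≡ c′ → w ≗ w′ → desFrom c w ≡ desFrom c′ w′
desFrom-cong {zero}  eq w≗w′ = refl
desFrom-cong {suc n} eq w≗w′ =
  cong₂ ℕ._+_ (cong₂ (λ x c → 𝟙 (x ℕ.<? c)) (w≗w′ zero) eq) (desFrom-cong (w≗w′ zero) (w≗w′ ∘ suc))

des≡desFrom : ∀ {m n} (w : Fin (suc n) → Fin m) → des w ≡ desFrom (toℕ (w zero)) (toℕ ∘ w ∘ suc)
des≡desFrom {m} {n} w = trans (count-tabulate (λ i → w (suc i) <ᶠ? w (inject₁ i)) id) (go w)
  where
  go : ∀ {n} (w : Fin (suc n) → Fin m) →
       sum (λ i → 𝟙 (w (suc i) <ᶠ? w (inject₁ i))) ≡ desFrom (toℕ (w zero)) (toℕ ∘ w ∘ suc)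
  go {zero}  w = refl
  go {suc n} w = cong (𝟙 (w (suc zero) <ᶠ? w zero) ℕ.+_) (go (w ∘ suc))

-- The threshold exceeds every letter, so the first comparison is always a descent; this is the
-- extra 1 in the exponent of the Eulerian polynomial.
des+1≡desFrom : ∀ {n} (π : Vec (Fin (suc n)) (suc n)) →
                des (lookup π) ℕ.+ 1 ≡ desFrom (suc n) (toℕ ∘ lookup π)
des+1≡desFrom {n} π = begin
  des (lookup π) ℕ.+ 1                ≡⟨ ℕ.+-comm _ 1 ⟩
  suc (des (lookup π))                ≡⟨ cong suc (des≡desFrom (lookup π)) ⟩
  1 ℕ.+ rest                          ≡⟨ cong (ℕ._+ rest) (𝟙-yes (_ ℕ.<? suc n) (toℕ<n (lookup π zero))) ⟨
  desFrom (suc n) (toℕ ∘ lookup π)    ∎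
  where
  open ≡-Reasoning
  rest = desFrom (toℕ (lookup π zero)) (toℕ ∘ lookup π ∘ suc)

-- Prepending a first letter to a permutation.

-- Skipping the value `i` fixes everything below `i` and moves the rest above it.
punchIn-<-pivot : ∀ {n} (i : Fin (suc n)) (j : Fin n) → toℕ (punchIn i j) < toℕ i ⇔ toℕ j < toℕ i
punchIn-<-pivot zero    j       = mk⇔ (λ ()) (λ ())
punchIn-<-pivot (suc i) zero    = mk⇔ (λ _ → ℕ.z<s) (λ _ → ℕ.z<s)
punchIn-<-pivot (suc i) (suc j) = mk⇔
  (ℕ.s<s ∘ Equivalence.to (punchIn-<-pivot i j) ∘ ℕ.s<s⁻¹)
  (ℕ.s<s ∘ Equivalence.from (punchIn-<-pivot i j) ∘ ℕ.s<s⁻¹)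

punchIn-<-⇔ : ∀ {n} (i : Fin (suc n)) (j k : Fin n) → toℕ (punchIn i j) < toℕ (punchIn i k) ⇔ toℕ j < toℕ k
punchIn-<-⇔ i j k = mk⇔
  (λ lt → ℕ.≰⇒> (λ k≤j → ℕ.<⇒≱ lt (punchIn-mono-≤ i k j k≤j)))
  (λ lt → ℕ.≰⇒> (λ le → ℕ.<⇒≱ lt (punchIn-cancel-≤ i k j le)))

-- The permutation that starts with `x` and whose remaining letters standardize to `σ`.
_◂_ : ∀ {n} → Fin (suc n) → Vec (Fin n) n → Vec (Fin (suc n)) (suc n)
x ◂ σ = x ∷ Vec.map (punchIn x) σ

desFrom-◂ : ∀ {n} c (x : Fin (suc n)) (σ : Vec (Fin n) n) →
            desFrom c (toℕ ∘ lookup (x ◂ σ)) ≡ 𝟙 (toℕ x ℕ.<? c) ℕ.+ desFrom (toℕ x) (toℕ ∘ lookup σ)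
desFrom-◂ c x σ = cong (𝟙 (toℕ x ℕ.<? c) ℕ.+_) (trans
  (desFrom-cong refl (λ i → cong toℕ (lookup-map i (punchIn x) σ)))
  (desFrom-⇔ (λ i → punchIn-<-pivot x (lookup σ i)) (λ i j → punchIn-<-⇔ x (lookup σ i) (lookup σ j))))

◂-injective : ∀ {n} {x y : Fin (suc n)} {σ τ : Vec (Fin n) n} → x ◂ σ ≡ y ◂ τ → x ≡ y ∧ σ ≡ τ
◂-injective {x = x} {σ = σ} {τ} eq with refl ← cong Vec.head eq =
  refl , lookup-injective λ i → punchIn-injective x _ _ (begin
    punchIn x (lookup σ i)           ≡⟨ lookup-map i (punchIn x) σ ⟨
    lookup (Vec.map (punchIn x) σ) i ≡⟨ cong (λ v → lookup v (suc i)) eq ⟩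
    lookup (Vec.map (punchIn x) τ) i ≡⟨ lookup-map i (punchIn x) τ ⟩
    punchIn x (lookup τ i)           ∎)
  where open ≡-Reasoning

◂-isPermutation : ∀ {n} (x : Fin (suc n)) (σ : Vec (Fin n) n) → IsPermutation σ → IsPermutation (x ◂ σ)
◂-isPermutation x σ (inj , _) = injective⇒isPermutation (x ◂ σ) go
  where
  at : ∀ i → lookup (x ◂ σ) (suc i) ≡ punchIn x (lookup σ i)
  at i = lookup-map i (punchIn x) σ
  go : Injective _≡_ _≡_ (lookup (x ◂ σ))
  go {zero}  {zero}  eq = refl
  go {zero}  {suc j} eq = contradiction (sym (trans eq (at j))) (punchInᵢ≢i x _)
  go {suc i} {zero}  eq = contradiction (trans (sym (at i)) eq) (punchInᵢ≢i x _)
  go {suc i} {suc j} eq = cong suc (inj (punchIn-injective x _ _ (trans (sym (at i)) (trans eq (at j)))))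

-- All letters after the first differ from `x`, so `x` can be punched out of them.
◂-surjective : ∀ {n} (π : Vec (Fin (suc n)) (suc n)) → IsPermutation π →
               ∃ λ x → ∃ λ σ → IsPermutation σ ∧ x ◂ σ ≡ π
◂-surjective (x ∷ w) (inj , _) = x , σ , injective⇒isPermutation σ σ-injective , cong (x ∷_) (lookup-injective back)
  where
  x≢ : ∀ i → x ≢ lookup w i
  x≢ i eq with () ← inj {zero} {suc i} eq
  σ = tabulate (λ i → punchOut (x≢ i))
  σ-injective : Injective _≡_ _≡_ (lookup σ)
  σ-injective {i} {j} eq = suc-injective (inj (punchOut-injective (x≢ i) (x≢ j)
    (trans (sym (lookup∘tabulate _ i)) (trans eq (lookup∘tabulate _ j)))))
  back : lookup (Vec.map (punchIn x) σ) ≗ lookup w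
  back i = begin
    lookup (Vec.map (punchIn x) σ) i ≡⟨ lookup-map i (punchIn x) σ ⟩
    punchIn x (lookup σ i)           ≡⟨ cong (punchIn x) (lookup∘tabulate _ i) ⟩
    punchIn x (punchOut (x≢ i))      ≡⟨ punchIn-punchOut (x≢ i) ⟩
    lookup w i                       ∎
    where open ≡-Reasoning

-- Relabelling the letters by a bijection.

map-isPermutation : ∀ {n} {ρ : Fin n → Fin n} → Injective _≡_ _≡_ ρ →
                    ∀ τ → IsPermutation τ → IsPermutation (Vec.map ρ τ)
map-isPermutation {ρ = ρ} ρ-inj τ (inj , _) = injective⇒isPermutation (Vec.map ρ τ) λ {i} {j} eq →
  inj (ρ-inj (trans (sym (lookup-map i ρ τ)) (trans eq (lookup-map j ρ τ))))

map-injective : ∀ {n} {ρ : Fin n → Fin n} → Injective _≡_ _≡_ ρ →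
                ∀ {σ τ : Vec (Fin n) n} → Vec.map ρ σ ≡ Vec.map ρ τ → σ ≡ τ
map-injective {ρ = ρ} ρ-inj {σ} {τ} eq = lookup-injective λ i →
  ρ-inj (trans (sym (lookup-map i ρ σ)) (trans (cong (λ v → lookup v i) eq) (lookup-map i ρ τ)))

map-surjective : ∀ {n} {ρ : Fin n → Fin n} → Injective _≡_ _≡_ ρ → ∀ σ → IsPermutation σ →
                 ∃ λ τ → IsPermutation τ ∧ Vec.map ρ τ ≡ σ
map-surjective {ρ = ρ} ρ-inj σ (inj , _) = τ , injective⇒isPermutation τ τ-injective , lookup-injective λ i →
  trans (lookup-map i ρ τ) (ρτ i)
  where
  ρ⁻¹ : ∀ a → ∃ λ b → ρ b ≡ a
  ρ⁻¹ = injective⇒hits ρ-inj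
  τ = Vec.map (proj₁ ∘ ρ⁻¹) σ
  ρτ : ∀ i → ρ (lookup τ i) ≡ lookup σ i
  ρτ i = trans (cong ρ (lookup-map i _ σ)) (proj₂ (ρ⁻¹ (lookup σ i)))
  τ-injective : Injective _≡_ _≡_ (lookup τ)
  τ-injective {i} {j} eq = inj (trans (sym (ρτ i)) (trans (cong ρ eq) (ρτ j)))

-- Standardization of an alphabet of distinct numbers.

module Standardization {n} (l : Fin n → ℕ) (l-injective : Injective _≡_ _≡_ l) where

  -- Defined at every number and not only at letters, so that a threshold outside the alphabet has a
  -- rank as well.
  rank : ℕ → ℕ
  rank x = sum (λ b → 𝟙 (l b ℕ.<? x))

  rank-mono-≤ : ∀ {x y} → x ≤ y → rank x ≤ rank y
  rank-mono-≤ x≤y = sum-mono-≤ λ b → 𝟙-mono (l b ℕ.<? _) (l b ℕ.<? _) λ lt → ℕ.<-≤-trans lt x≤y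

  -- The letter `l a` is itself counted in the rank of `y` but not in its own rank.
  rank-mono-< : ∀ {a y} → l a < y → rank (l a) < rank y
  rank-mono-< {a} {y} la<y = sum-mono-<
    (λ b → 𝟙-mono (l b ℕ.<? l a) (l b ℕ.<? y) λ lt → ℕ.<-trans lt la<y) a
    (subst₂ _<_ (sym (𝟙-no (l a ℕ.<? l a) (ℕ.<-irrefl refl))) (sym (𝟙-yes (l a ℕ.<? y) la<y)) ℕ.z<s)

  rank-⇔ : ∀ a x → l a < x ⇔ rank (l a) < rank x
  rank-⇔ a x = mk⇔ rank-mono-< λ lt → ℕ.≰⇒> λ x≤la → ℕ.<⇒≱ lt (rank-mono-≤ x≤la)

  rank<n : ∀ a → rank (l a) < n
  -- Compared with a sum of `n` ones, the term at `a` is 0 because `l a` is not below itself.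
  rank<n a = subst (rank (l a) <_) (sum-ones n) (sum-mono-< (λ b → 𝟙≤1 (l b ℕ.<? l a)) a
    (ℕ.≤-reflexive (cong suc (𝟙-no (l a ℕ.<? l a) (ℕ.<-irrefl refl)))))

  ρ : Fin n → Fin n
  ρ a = fromℕ< (rank<n a)

  toℕ-ρ : ∀ a → toℕ (ρ a) ≡ rank (l a)
  toℕ-ρ a = toℕ-fromℕ< (rank<n a)

  ρ-injective : Injective _≡_ _≡_ ρ
  ρ-injective {a} {b} eq = l-injective (ℕ.≤-antisym (≤ₗ a b (ℕ.≤-reflexive req)) (≤ₗ b a (ℕ.≤-reflexive (sym req))))
    where
    req : rank (l a) ≡ rank (l b)
    req = trans (sym (toℕ-ρ a)) (trans (cong toℕ eq) (toℕ-ρ b))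
    ≤ₗ : ∀ a b → rank (l a) ≤ rank (l b) → l a ≤ l b
    ≤ₗ a b le = ℕ.≮⇒≥ λ lt → ℕ.<⇒≱ (rank-mono-< lt) le

  -- `rank-⇔` preserves comparisons of a letter with any number, hence both those among letters and
  -- those with `c`.
  desFrom-ρ : ∀ c (τ : Vec (Fin n) n) →
              desFrom c (l ∘ lookup τ) ≡ desFrom (rank c) (toℕ ∘ lookup (Vec.map ρ τ))
  desFrom-ρ c τ = trans
    (desFrom-⇔ (λ i → rank-⇔ (lookup τ i) c) (λ i j → rank-⇔ (lookup τ i) (l (lookup τ j))))
    (desFrom-cong refl λ i → sym (trans (cong toℕ (lookup-map i ρ τ)) (toℕ-ρ (lookup τ i))))

-- Signs and the symmetric alphabet.

-- A sign is an element of Fin 2, with 1 for minus.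
act : ∀ {m} → Fin 2 → Fin m → Fin m
act zero       x = x
act (suc zero) x = opposite x

act-involutive : ∀ {m} s (x : Fin m) → act s (act s x) ≡ x
act-involutive zero       x = refl
act-involutive (suc zero) x = opposite-involutive x

-- Applied to `Fin 2` itself, `act` is multiplication of signs, where cancellation holds.
act-injectiveˡ : ∀ {s s′} (r : Fin 2) → act s r ≡ act s′ r → s ≡ s′
act-injectiveˡ {zero}     {zero}     r          eq = refl
act-injectiveˡ {suc zero} {suc zero} r          eq = refl
act-injectiveˡ {zero}     {suc zero} zero       ()
act-injectiveˡ {zero}     {suc zero} (suc zero) ()
act-injectiveˡ {suc zero} {zero}     zero       ()
act-injectiveˡ {suc zero} {zero}     (suc zero) ()

origin : ∀ {n} → ± n
origin {n} = nonNeg {n} zero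

-- The integer `±(a + 1)` with sign `s`.
letter : ∀ {n} → Fin 2 → Fin n → ± n
letter {n} s a = act s (nonNeg {n} (suc a))

toℕ-origin : ∀ n → toℕ (origin {n}) ≡ n
toℕ-origin n = trans (toℕ-↑ʳ n zero) (ℕ.+-identityʳ n)

toℕ-opposite-nonNeg : ∀ {n} (i : Fin (suc n)) → toℕ (opposite (nonNeg {n} i)) ≡ n ∸ toℕ i
toℕ-opposite-nonNeg {n} i = begin
  toℕ (opposite (nonNeg {n} i))                ≡⟨ opposite-prop (nonNeg {n} i) ⟩
  n ℕ.+ suc n ∸ suc (toℕ (nonNeg {n} i))       ≡⟨ cong₂ (λ a b → a ∸ suc b) (ℕ.+-suc n n) (toℕ-↑ʳ n i) ⟩
  (n ℕ.+ n) ∸ (n ℕ.+ toℕ i)                    ≡⟨ ℕ.[m+n]∸[m+o]≡n∸o n n (toℕ i) ⟩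
  n ∸ toℕ i                                    ∎
  where open ≡-Reasoning

opposite-origin : ∀ {n} → opposite (origin {n}) ≡ origin {n}
opposite-origin {n} = toℕ-injective (trans (toℕ-opposite-nonNeg {n} zero) (sym (toℕ-origin n)))

-- The negative values fill the first `n` places of `± n`, in reverse order of absolute value.
letter-negative : ∀ {n} (a : Fin n) → letter {n} (suc zero) a ≡ opposite a ↑ˡ suc n
letter-negative {n} a = toℕ-injective (begin
  toℕ (letter {n} (suc zero) a)   ≡⟨ toℕ-opposite-nonNeg (suc a) ⟩
  n ∸ suc (toℕ a)                 ≡⟨ opposite-prop a ⟨
  toℕ (opposite a)                ≡⟨ toℕ-↑ˡ (opposite a) (suc n) ⟨
  toℕ (opposite a ↑ˡ suc n)       ∎)
  where open ≡-Reasoning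

opposite-letter : ∀ {n} s (a : Fin n) → opposite (letter {n} s a) ≡ letter (opposite s) a
opposite-letter zero       a = refl
opposite-letter (suc zero) a = opposite-involutive _

act-letter : ∀ {n} s r (a : Fin n) → act s (letter {n} r a) ≡ letter (act s r) a
act-letter zero       r a = refl
act-letter (suc zero) r a = opposite-letter r a

-- Zero is represented by `n`, so lying below `n` means being negative.
letter-sign : ∀ {n} s (a : Fin n) → 𝟙 (toℕ (letter {n} s a) ℕ.<? n) ≡ toℕ s
letter-sign {n} zero       a = 𝟙-no (_ ℕ.<? n) λ lt →
  ℕ.m+n≮m n (suc (toℕ a)) (subst (_< n) (toℕ-↑ʳ n (suc a)) lt)
letter-sign {n} (suc zero) a = 𝟙-yes (_ ℕ.<? n)
  (subst (_< n) (sym (trans (cong toℕ (letter-negative a)) (toℕ-↑ˡ (opposite a) (suc n)))) (toℕ<n (opposite a)))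

-- `letter-sign` recovers the sign; applying that sign once more recovers the absolute value.
letter-injective : ∀ {n} s s′ {a a′ : Fin n} → letter {n} s a ≡ letter s′ a′ → s ≡ s′ ∧ a ≡ a′
letter-injective {n} s s′ {a} {a′} eq = s≡s′ , suc-injective (↑ʳ-injective n _ _ (begin
  nonNeg (suc a)           ≡⟨ act-involutive s _ ⟨
  act s (letter {n} s a)   ≡⟨ cong₂ act s≡s′ eq ⟩
  act s′ (letter s′ a′)    ≡⟨ act-involutive s′ _ ⟩
  nonNeg (suc a′)          ∎))
  where
  open ≡-Reasoning
  s≡s′ : s ≡ s′
  s≡s′ = toℕ-injective (trans (sym (letter-sign s a)) (trans (cong (λ x → 𝟙 (toℕ x ℕ.<? n)) eq) (letter-sign s′ a′)))

act-origin : ∀ {n} s → act s (origin {n}) ≡ origin {n}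
act-origin     zero       = refl
act-origin {n} (suc zero) = opposite-origin {n}

letter≢origin : ∀ {n} s {a : Fin n} → letter {n} s a ≢ origin {n}
letter≢origin {n} s {a} eq with () ← ↑ʳ-injective n (suc a) zero
  (trans (sym (act-involutive s _)) (trans (cong (act s) eq) (act-origin {n} s)))

-- A view of `± n` as zero together with the signed letters, used for case analysis.
data Signed {n} : ± n → Set where
  isOrigin : Signed origin
  isLetter : ∀ s a → Signed (letter s a)

signed : ∀ {n} (x : ± n) → Signed {n} x
signed {n} x with splitAt n x in eq
... | inj₁ j       = subst (Signed {n}) letter≡x (isLetter (suc zero) (opposite j))
  where
  letter≡x : letter {n} (suc zero) (opposite j) ≡ x
  letter≡x = trans (letter-negative (opposite j)) (trans (cong (_↑ˡ suc n) (opposite-involutive j)) (splitAt⁻¹-↑ˡ eq))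
... | inj₂ zero    = subst (Signed {n}) (splitAt⁻¹-↑ʳ eq) isOrigin
... | inj₂ (suc a) = subst (Signed {n}) (splitAt⁻¹-↑ʳ eq) (isLetter zero a)

-- Signed permutations from signs and permutations.

oddExtension : ∀ {n} → (Fin n → ± n) → ± n → ± n
oddExtension {n} h x with splitAt n x
-- The place `j` among the negative values represents minus the letter `opposite j`.
... | inj₁ j       = opposite (h (opposite j))
... | inj₂ zero    = origin {n}
... | inj₂ (suc i) = h i

oddExtension-origin : ∀ {n} (h : Fin n → ± n) → oddExtension h (origin {n}) ≡ origin {n}
oddExtension-origin {n} h rewrite splitAt-↑ʳ n (suc n) zero = refl

oddExtension-letter : ∀ {n} (h : Fin n → ± n) s i → oddExtension h (letter {n} s i) ≡ act s (h i)
oddExtension-letter {n} h zero       i rewrite splitAt-↑ʳ n (suc n) (suc i) = refl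
oddExtension-letter {n} h (suc zero) i
  rewrite letter-negative i | splitAt-↑ˡ n (opposite i) (suc n) | opposite-involutive i = refl

-- Signs are indexed by letters, not by positions, so that they fix the set of
-- letters of w while τ varies.
letters : ∀ {n} → Vec (Fin 2) n → Fin n → ± n
letters {n} ε a = letter {n} (lookup ε a) a

-- The signed permutation with absolute values `τ` in which the letter `a` carries the sign
-- `lookup ε a`.
assemble : ∀ {n} → Vec (Fin 2) n ∧ Vec (Fin n) n → Vec (± n) (n ℕ.+ suc n)
assemble {n} (ε , τ) = tabulate (oddExtension (letters ε ∘ lookup τ))

module _ {n} (ε : Vec (Fin 2) n) (τ : Vec (Fin n) n) where

  private
    π : Vec (± n) (n ℕ.+ suc n)
    π = assemble (ε , τ)

  assemble-origin : lookup π (origin {n}) ≡ origin {n}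
  assemble-origin = trans (lookup∘tabulate _ (origin {n})) (oddExtension-origin (letters ε ∘ lookup τ))

  assemble-letter : ∀ s i → lookup π (letter {n} s i) ≡ letter (act s (lookup ε (lookup τ i))) (lookup τ i)
  assemble-letter s i = trans (lookup∘tabulate _ (letter {n} s i))
    (trans (oddExtension-letter (letters ε ∘ lookup τ) s i) (act-letter s _ _))

  -- Equal values have equal absolute values, so `τ` identifies the positions up to sign; cancelling
  -- the sign of the common letter then identifies the signs of the positions.
  assemble-isSigned : IsPermutation τ → IsSignedPermutation π
  assemble-isSigned (inj , _) = injective⇒isPermutation π (λ {x} {y} → π-injective (signed x) (signed y)) , λ x → odd (signed x)
    where
    π-injective : ∀ {x y} → Signed {n} x → Signed {n} y → lookup π x ≡ lookup π y → x ≡ y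
    π-injective isOrigin isOrigin eq = refl
    π-injective isOrigin (isLetter s i) eq =
      contradiction (trans (sym (assemble-letter s i)) (trans (sym eq) assemble-origin)) (letter≢origin (act s _))
    π-injective (isLetter s i) isOrigin eq =
      contradiction (trans (sym (assemble-letter s i)) (trans eq assemble-origin)) (letter≢origin (act s _))
    π-injective (isLetter s i) (isLetter r j) eq
      with signs , τi≡τj ← letter-injective (act s _) (act r _)
             (trans (sym (assemble-letter s i)) (trans eq (assemble-letter r j)))
      with refl ← inj τi≡τj
      with refl ← act-injectiveˡ {s} {r} (lookup ε (lookup τ i)) signs = refl

    odd : ∀ {x} → Signed {n} x → lookup π (opposite x) ≡ opposite (lookup π x)
    odd isOrigin = begin
      lookup π (opposite (origin {n})) ≡⟨ cong (lookup π) (opposite-origin {n}) ⟩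
      lookup π (origin {n})            ≡⟨ assemble-origin ⟩
      origin {n}                       ≡⟨ opposite-origin {n} ⟨
      opposite (origin {n})            ≡⟨ cong opposite assemble-origin ⟨
      opposite (lookup π (origin {n})) ∎
      where open ≡-Reasoning
    odd (isLetter s i) = begin
      lookup π (opposite (letter {n} s i))    ≡⟨ cong (lookup π) (opposite-letter s i) ⟩
      lookup π (letter {n} (opposite s) i)    ≡⟨ assemble-letter (opposite s) i ⟩
      letter (act (opposite s) _) _           ≡⟨ cong (λ r → letter r _) (act-opposite s _) ⟩
      letter (opposite (act s _)) _           ≡⟨ opposite-letter (act s _) _ ⟨
      opposite (letter (act s _) _)           ≡⟨ cong opposite (assemble-letter s i) ⟨
      opposite (lookup π (letter {n} s i))    ∎
      where
      open ≡-Reasoning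
      act-opposite : ∀ s (r : Fin 2) → act (opposite s) r ≡ opposite (act s r)
      act-opposite zero       r = refl
      act-opposite (suc zero) r = sym (opposite-involutive r)

  -- The value at position 0 is zero, represented by `n`, and it becomes the threshold.
  desB-assemble : desB {n} π ≡ desFrom n (toℕ ∘ letters ε ∘ lookup τ)
  desB-assemble = trans (des≡desFrom (λ i → lookup π (nonNeg {n} i)))
    (desFrom-cong (trans (cong toℕ assemble-origin) (toℕ-origin n)) λ i → cong toℕ (assemble-letter zero i))

  neg-assemble : IsPermutation τ → neg {n} π ≡ sum (toℕ ∘ lookup ε)
  neg-assemble perm = begin
    neg {n} π
      ≡⟨ count-tabulate (λ i → lookup π (nonNeg {n} (suc i)) <ᶠ? nonNeg {n} zero) id ⟩
    sum (λ i → 𝟙 (lookup π (nonNeg {n} (suc i)) <ᶠ? nonNeg {n} zero))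
      ≡⟨ sum-cong-≗ (λ i → trans
           (cong₂ (λ x y → 𝟙 (x ℕ.<? y)) (cong toℕ (assemble-letter zero i)) (toℕ-origin n))
           (letter-sign _ (lookup τ i))) ⟩
    sum (λ i → toℕ (lookup ε (lookup τ i)))
      -- The signs belong to letters while `neg` counts positions; `τ` reindexes one by the other.
      ≡⟨ sum-permute (toℕ ∘ lookup ε) (Inverse.toPermutation τ perm) ⟨
    sum (toℕ ∘ lookup ε) ∎
    where open ≡-Reasoning

-- The positive positions determine `τ` and the sign of each letter that `τ` takes, and `τ` takes
-- every letter.
assemble-injective : ∀ {n} {ε ε′ : Vec (Fin 2) n} {τ τ′ : Vec (Fin n) n} → IsPermutation τ →
                     assemble (ε , τ) ≡ assemble (ε′ , τ′) → (ε , τ) ≡ (ε′ , τ′)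
assemble-injective {n} {ε} {ε′} {τ} {τ′} perm eq = cong₂ _,_ (lookup-injective ε≗ε′) τ≡τ′
  where
  open Inverse τ perm
  parts : ∀ i → lookup ε (lookup τ i) ≡ lookup ε′ (lookup τ′ i) ∧ lookup τ i ≡ lookup τ′ i
  parts i = letter-injective _ _ (trans (sym (assemble-letter ε τ zero i))
    (trans (cong (λ π → lookup π (letter {n} zero i)) eq) (assemble-letter ε′ τ′ zero i)))
  τ≡τ′ : τ ≡ τ′
  τ≡τ′ = lookup-injective (proj₂ ∘ parts)
  ε≗ε′ : lookup ε ≗ lookup ε′
  ε≗ε′ a = begin
    lookup ε a                          ≡⟨ cong (lookup ε) (lookup-position a) ⟨
    lookup ε (lookup τ (position a))    ≡⟨ proj₁ (parts (position a)) ⟩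
    lookup ε′ (lookup τ′ (position a))  ≡⟨ cong (λ σ → lookup ε′ (lookup σ (position a))) τ≡τ′ ⟨
    lookup ε′ (lookup τ (position a))   ≡⟨ cong (lookup ε′) (lookup-position a) ⟩
    lookup ε′ a                         ∎
    where open ≡-Reasoning

-- Zero is the only fixed point of negation, so the odd map `π` fixes it. Every positive position
-- therefore holds a signed letter; the absolute values form `τ`.
assemble-surjective : ∀ {n} (π : Vec (± n) (n ℕ.+ suc n)) → IsSignedPermutation π →
                      ∃ λ ε → ∃ λ τ → IsPermutation τ ∧ assemble (ε , τ) ≡ π
assemble-surjective {n} π ((inj , _) , odd) = ε , τ , τ-perm , lookup-injective λ x → agree (signed x)
  where
  open ≡-Reasoning

  origin-unique : ∀ {x} → Signed {n} x → opposite x ≡ x → x ≡ origin {n}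
  origin-unique isOrigin             eq = refl
  origin-unique (isLetter zero a)    eq with () ← proj₁ (letter-injective {n} (suc zero) zero eq)
  origin-unique (isLetter (suc zero) a) eq
    with () ← proj₁ (letter-injective {n} zero (suc zero) (trans (sym (opposite-letter {n} (suc zero) a)) eq))

  π-origin : lookup π (origin {n}) ≡ origin {n}
  π-origin = origin-unique (signed _) (trans (sym (odd (origin {n}))) (cong (lookup π) (opposite-origin {n})))

  π-letter : ∀ s i → lookup π (letter {n} s i) ≡ act s (lookup π (letter {n} zero i))
  π-letter zero       i = refl
  π-letter (suc zero) i = odd (letter {n} zero i)

  decompose : ∀ i → ∃ λ s → ∃ λ a → lookup π (letter {n} zero i) ≡ letter s a
  decompose i = go (signed _) refl
    where
    go : ∀ {x} → Signed {n} x → lookup π (letter {n} zero i) ≡ x → ∃ λ s → ∃ λ a → lookup π (letter {n} zero i) ≡ letter s a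
    go isOrigin       eq = contradiction (inj (trans eq (sym π-origin))) (letter≢origin zero)
    go (isLetter s a) eq = s , a , eq

  s : Fin n → Fin 2
  s i = proj₁ (decompose i)

  τ = tabulate (λ i → proj₁ (proj₂ (decompose i)))

  π-sτ : ∀ i → lookup π (letter {n} zero i) ≡ letter (s i) (lookup τ i)
  π-sτ i = trans (proj₂ (proj₂ (decompose i))) (cong (letter (s i)) (sym (lookup∘tabulate _ i)))

  -- Moving the sign from value to position makes the value positive, so equal absolute values
  -- become equal values of `π` and its injectivity passes to `τ`.
  π-τ : ∀ i → lookup π (letter {n} (s i) i) ≡ letter zero (lookup τ i)
  π-τ i = begin
    lookup π (letter {n} (s i) i)               ≡⟨ π-letter (s i) i ⟩
    act (s i) (lookup π (letter {n} zero i))    ≡⟨ cong (act (s i)) (π-sτ i) ⟩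
    act (s i) (letter (s i) (lookup τ i))       ≡⟨ act-involutive (s i) _ ⟩
    letter zero (lookup τ i)                    ∎

  τ-perm : IsPermutation τ
  τ-perm = injective⇒isPermutation τ λ {i} {j} eq →
    proj₂ (letter-injective (s i) (s j) (inj (trans (π-τ i) (trans (cong (letter zero) eq) (sym (π-τ j))))))

  open Inverse τ τ-perm

  -- The sign of a letter is the one found at the position where the letter occurs.
  ε = tabulate (s ∘ position)

  agree : ∀ {x} → Signed {n} x → lookup (assemble (ε , τ)) x ≡ lookup π x
  agree isOrigin       = trans (assemble-origin ε τ) (sym π-origin)
  agree (isLetter r i) = begin
    lookup (assemble (ε , τ)) (letter {n} r i)
      ≡⟨ assemble-letter ε τ r i ⟩
    letter (act r (lookup ε (lookup τ i))) (lookup τ i)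
      ≡⟨ act-letter r _ _ ⟨
    act r (letter (lookup ε (lookup τ i)) (lookup τ i))
      ≡⟨ cong (λ q → act r (letter q (lookup τ i)))
           (trans (lookup∘tabulate _ (lookup τ i)) (cong s (position-lookup i))) ⟩
    act r (letter (s i) (lookup τ i))
      ≡⟨ cong (act r) (π-sτ i) ⟨
    act r (lookup π (letter {n} zero i))
      ≡⟨ π-letter r i ⟨
    lookup π (letter {n} r i) ∎

-- Enumerations without repetition.

words-unique : ∀ m n → Unique (words m n)
words-unique m zero    = All.[] ∷ []
words-unique m (suc n) = Unique.cartesianProductWith⁺ _∷_ ∷-injective (Unique.allFin⁺ m) (words-unique m n)

∈-words : ∀ {m n} (w : Vec (Fin m) n) → w ∈ words m n
∈-words []      = here refl
∈-words (x ∷ w) = ∈-cartesianProductWith⁺ _∷_ (∈-allFin x) (∈-words w)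

𝔖-unique : ∀ n → Unique (𝔖 n)
𝔖-unique n = Unique.filter⁺ isPermutation? (words-unique n n)

∈-𝔖⁺ : ∀ {n} {π : Vec (Fin n) n} → IsPermutation π → π ∈ 𝔖 n
∈-𝔖⁺ {π = π} = ∈-filter⁺ isPermutation? (∈-words π)

∈-𝔖⁻ : ∀ {n} {π : Vec (Fin n) n} → π ∈ 𝔖 n → IsPermutation π
∈-𝔖⁻ {n} = proj₂ ∘ ∈-filter⁻ isPermutation? {xs = words n n}

𝔅-unique : ∀ n → Unique (𝔅 n)
𝔅-unique n = Unique.filter⁺ (isSignedPermutation? {n}) (words-unique (n ℕ.+ suc n) (n ℕ.+ suc n))

∈-𝔅⁺ : ∀ {n} {π : Vec (± n) (n ℕ.+ suc n)} → IsSignedPermutation {n} π → π ∈ 𝔅 n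
∈-𝔅⁺ {n} {π} = ∈-filter⁺ (isSignedPermutation? {n}) (∈-words π)

∈-𝔅⁻ : ∀ {n} {π : Vec (± n) (n ℕ.+ suc n)} → π ∈ 𝔅 n → IsSignedPermutation {n} π
∈-𝔅⁻ {n} = proj₂ ∘ ∈-filter⁻ (isSignedPermutation? {n}) {xs = words (n ℕ.+ suc n) (n ℕ.+ suc n)}

module _ {A B : Set} (g : A → B) where

  -- Injectivity is asked on the list only: `assemble` is shown injective when `τ` is a permutation.
  unique-map : ∀ {xs} → Unique xs → (∀ {x y} → x ∈ xs → y ∈ xs → g x ≡ g y → x ≡ y) → Unique (List.map g xs)
  unique-map []              inj = []
  unique-map (x∉xs ∷ unique) inj =
    All.map⁺ (All.tabulate λ y∈xs gx≡gy → All.lookup x∉xs y∈xs (inj (here refl) (there y∈xs) gx≡gy))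
    ∷ unique-map unique λ x∈ y∈ → inj (there x∈) (there y∈)

  map-↭ : ∀ {xs ys} → Unique xs → Unique ys →
          (∀ {x y} → x ∈ xs → y ∈ xs → g x ≡ g y → x ≡ y) →
          (∀ {x} → x ∈ xs → g x ∈ ys) → (∀ {y} → y ∈ ys → ∃ λ x → x ∈ xs ∧ g x ≡ y) →
          List.map g xs ↭ ys
  map-↭ {xs} {ys} unique-xs unique-ys inj into onto =
    ∼bag⇒↭ (unique∧set⇒bag (unique-map unique-xs inj) unique-ys (mk⇔ to from))
    where
    to : ∀ {y} → y ∈ List.map g xs → y ∈ ys
    to y∈ with _ , x∈ , refl ← ∈-map⁻ g y∈ = into x∈
    from : ∀ {y} → y ∈ ys → y ∈ List.map g xs
    from y∈ with _ , x∈ , refl ← onto y∈ = ∈-map⁺ g x∈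

module Evaluation {a ℓ} (R : CommutativeRing a ℓ) where

  private module R = CommutativeRing R
  open R using (Carrier; _≈_; _+_; _*_; -_; _-_; 0#; 1#; +-cong; +-congˡ; +-congʳ; *-cong; *-congˡ; *-congʳ)
  open import Algebra.Properties.Semiring.Exp R.semiring using (_^_; ^-homo-*; ^-congʳ)
  open import Algebra.Properties.Semiring.Mult R.semiring using (×-comm-*; ×-homo-+; ×-congʳ; ×-congˡ; _×_)
  open import Algebra.Properties.Semiring.Sum R.semiring
    using (sum-syntax; sum⁺-syntax; sum-cong-≋; sum-init-last; ∑-distrib-+; *-distribˡ-sum) renaming (sum to ∑)
  open import Algebra.Solver.Ring.NaturalCoefficients.Default R.commutativeSemiring using (solve; _:+_; _:*_; _:=_)
  open import Relation.Binary.Reasoning.Setoid R.setoid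
  open EulerianPolynomials R

  -- Sums over lists in the ring.

  sumOver-cong : ∀ {X : Set} (xs : List X) {f g : X → Carrier} → (∀ {x} → x ∈ xs → f x ≈ g x) → sumOver xs f ≈ sumOver xs g
  sumOver-cong []       f≈g = R.refl
  sumOver-cong (x ∷ xs) f≈g = +-cong (f≈g (here refl)) (sumOver-cong xs (f≈g ∘ there))

  sumOver-++ : ∀ {X : Set} (xs ys : List X) {f : X → Carrier} → sumOver (xs List.++ ys) f ≈ sumOver xs f + sumOver ys f
  sumOver-++ []       ys = R.sym (R.+-identityˡ _)
  sumOver-++ (x ∷ xs) ys = R.trans (+-congˡ (sumOver-++ xs ys)) (R.sym (R.+-assoc _ _ _))

  sumOver-map : ∀ {X Y : Set} (g : X → Y) (xs : List X) {f : Y → Carrier} → sumOver (List.map g xs) f ≈ sumOver xs (f ∘ g)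
  sumOver-map g []       = R.refl
  sumOver-map g (x ∷ xs) = +-congˡ (sumOver-map g xs)

  sumOver-cartesianProductWith : ∀ {X Y Z : Set} (g : X → Y → Z) xs ys (f : Z → Carrier) →
    sumOver (cartesianProductWith g xs ys) f ≈ sumOver xs λ x → sumOver ys λ y → f (g x y)
  sumOver-cartesianProductWith g []       ys f = R.refl
  sumOver-cartesianProductWith g (x ∷ xs) ys f =
    R.trans (sumOver-++ (List.map (g x) ys) _) (+-cong (sumOver-map (g x) ys) (sumOver-cartesianProductWith g xs ys f))

  sumOver-* : ∀ {X : Set} c (xs : List X) {f : X → Carrier} → sumOver xs (λ x → c * f x) ≈ c * sumOver xs f
  sumOver-* c []       = R.sym (R.zeroʳ c)
  sumOver-* c (x ∷ xs) = R.trans (+-congˡ (sumOver-* c xs)) (R.sym (R.distribˡ c _ _))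

  sumOver-+ : ∀ {X : Set} (xs : List X) {f g : X → Carrier} → sumOver xs (λ x → f x + g x) ≈ sumOver xs f + sumOver xs g
  sumOver-+ []       = R.sym (R.+-identityˡ 0#)
  sumOver-+ (x ∷ xs) = R.trans (+-congˡ (sumOver-+ xs))
    (solve 4 (λ a b c d → (a :+ b) :+ (c :+ d) := (a :+ c) :+ (b :+ d)) R.refl _ _ _ _)

  sumOver-tabulate : ∀ {X : Set} {n} (g : Fin n → X) (f : X → Carrier) → sumOver (List.tabulate g) f ≈ ∑ (f ∘ g)
  sumOver-tabulate {n = zero}  g f = R.refl
  sumOver-tabulate {n = suc n} g f = +-congˡ (sumOver-tabulate (g ∘ suc) f)

  sumOver-↭ : ∀ {X : Set} {xs ys : List X} {f : X → Carrier} → xs ↭ ys → sumOver xs f ≈ sumOver ys f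
  sumOver-↭ {f = f} xs↭ys = foldr-commMonoid R.setoid R.+-isCommutativeMonoid (↭⇒↭ₛ′ R.isEquivalence (↭-map⁺ f xs↭ys))

  -- Without repetitions, the list of images of `xs` is a rearrangement of `ys`, and addition is
  -- commutative.
  sumOver-reindex : ∀ {X Y : Set} (g : X → Y) {xs ys} → Unique xs → Unique ys →
    (∀ {x y} → x ∈ xs → y ∈ xs → g x ≡ g y → x ≡ y) →
    (∀ {x} → x ∈ xs → g x ∈ ys) → (∀ {y} → y ∈ ys → ∃ λ x → x ∈ xs ∧ g x ≡ y) →
    ∀ (f : Y → Carrier) → sumOver ys f ≈ sumOver xs (f ∘ g)
  sumOver-reindex g {xs} unique-xs unique-ys inj into onto f =
    R.trans (R.sym (sumOver-↭ (map-↭ g unique-xs unique-ys inj into onto))) (sumOver-map g xs)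

  -- Changes of variables in sums over permutations.

  sumOver-𝔖-suc : ∀ n (f : Vec (Fin (suc n)) (suc n) → Carrier) →
    sumOver (𝔖 (suc n)) f ≈ ∑[ x < suc n ] sumOver (𝔖 n) λ σ → f (x ◂ σ)
  sumOver-𝔖-suc n f = begin
    sumOver (𝔖 (suc n)) f
      ≈⟨ sumOver-reindex (uncurry _◂_) (Unique.cartesianProduct⁺ (Unique.allFin⁺ (suc n)) (𝔖-unique n)) (𝔖-unique (suc n))
           (λ _ _ → uncurry (cong₂ _,_) ∘ ◂-injective) into onto f ⟩
    sumOver (cartesianProduct (List.allFin (suc n)) (𝔖 n)) (f ∘ uncurry _◂_)
      ≈⟨ sumOver-cartesianProductWith _,_ (List.allFin (suc n)) (𝔖 n) (f ∘ uncurry _◂_) ⟩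
    sumOver (List.allFin (suc n)) (λ x → sumOver (𝔖 n) λ σ → f (x ◂ σ))
      ≈⟨ sumOver-tabulate id (λ x → sumOver (𝔖 n) λ σ → f (x ◂ σ)) ⟩
    ∑[ x < suc n ] sumOver (𝔖 n) (λ σ → f (x ◂ σ)) ∎
    where
    into : ∀ {xσ} → xσ ∈ cartesianProduct (List.allFin (suc n)) (𝔖 n) → uncurry _◂_ xσ ∈ 𝔖 (suc n)
    into {x , σ} ∈× = ∈-𝔖⁺ (◂-isPermutation x σ (∈-𝔖⁻ (proj₂ (∈-cartesianProduct⁻ (List.allFin (suc n)) (𝔖 n) ∈×))))
    onto : ∀ {π} → π ∈ 𝔖 (suc n) → ∃ λ xσ → xσ ∈ cartesianProduct (List.allFin (suc n)) (𝔖 n) ∧ uncurry _◂_ xσ ≡ π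
    onto {π} π∈ = let x , σ , perm , eq = ◂-surjective π (∈-𝔖⁻ π∈) in
      (x , σ) , ∈-cartesianProduct⁺ (∈-allFin x) (∈-𝔖⁺ perm) , eq

  sumOver-𝔖-map : ∀ {n} {ρ : Fin n → Fin n} → Injective _≡_ _≡_ ρ → ∀ (f : Vec (Fin n) n → Carrier) →
    sumOver (𝔖 n) f ≈ sumOver (𝔖 n) (f ∘ Vec.map ρ)
  sumOver-𝔖-map {n} {ρ} ρ-inj = sumOver-reindex (Vec.map ρ) (𝔖-unique n) (𝔖-unique n)
    (λ _ _ → map-injective ρ-inj)
    (λ {τ} τ∈ → ∈-𝔖⁺ (map-isPermutation ρ-inj τ (∈-𝔖⁻ τ∈)))
    λ {σ} σ∈ → let τ , perm , eq = map-surjective ρ-inj σ (∈-𝔖⁻ σ∈) in τ , ∈-𝔖⁺ perm , eq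

  sumOver-𝔅 : ∀ n (f : Vec (± n) (n ℕ.+ suc n) → Carrier) →
    sumOver (𝔅 n) f ≈ sumOver (words 2 n) λ ε → sumOver (𝔖 n) λ τ → f (assemble (ε , τ))
  sumOver-𝔅 n f = R.trans
    (sumOver-reindex (assemble {n}) (Unique.cartesianProduct⁺ (words-unique 2 n) (𝔖-unique n)) (𝔅-unique n)
      (λ ∈× _ → assemble-injective (perm ∈×)) (λ {ετ} ∈× → ∈-𝔅⁺ {n} (assemble-isSigned (proj₁ ετ) (proj₂ ετ) (perm ∈×))) onto f)
    (sumOver-cartesianProductWith _,_ (words 2 n) (𝔖 n) (f ∘ assemble {n}))
    where
    perm : ∀ {ετ} → ετ ∈ cartesianProduct (words 2 n) (𝔖 n) → IsPermutation (proj₂ ετ)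
    perm = ∈-𝔖⁻ ∘ proj₂ ∘ ∈-cartesianProduct⁻ (words 2 n) (𝔖 n)
    onto : ∀ {π} → π ∈ 𝔅 n → ∃ λ ετ → ετ ∈ cartesianProduct (words 2 n) (𝔖 n) ∧ assemble ετ ≡ π
    onto {π} π∈ = let ε , τ , perm , eq = assemble-surjective {n} π (∈-𝔅⁻ {n} π∈) in
      (ε , τ) , ∈-cartesianProduct⁺ (∈-words ε) (∈-𝔖⁺ perm) , eq

  -- The threshold polynomials and their recurrence.

  module _ (t : Carrier) where

    Q : ℕ → ℕ → Carrier
    Q n c = sumOver (𝔖 n) λ σ → t ^ desFrom c (toℕ ∘ lookup σ)

    A≈Q : ∀ n → A n t ≈ Q n n
    A≈Q zero    = R.sym (R.+-identityʳ 1#)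
    A≈Q (suc n) = sumOver-cong (𝔖 (suc n)) λ {π} _ → ^-congʳ t (des+1≡desFrom π)

    -- Permutations are grouped by their first letter `x`, which contributes a factor `t` when below
    -- `c` and is the threshold for what follows.
    Q-suc : ∀ n c → Q (suc n) c ≈ ∑[ x < suc n ] (t ^ 𝟙 (toℕ x ℕ.<? c) * Q n (toℕ x))
    Q-suc n c = R.trans (sumOver-𝔖-suc n (λ σ → t ^ desFrom c (toℕ ∘ lookup σ))) (sum-cong-≋ λ x → R.trans
      (sumOver-cong (𝔖 n) λ {σ} _ → R.trans (^-congʳ t (desFrom-◂ c x σ)) (^-homo-* t (𝟙 (toℕ x ℕ.<? c)) _))
      (sumOver-* (t ^ 𝟙 (toℕ x ℕ.<? c)) (𝔖 n)))

    1≈t+[1-t] : 1# ≈ t + (1# - t)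
    1≈t+[1-t] = begin
      1#              ≈⟨ R.+-identityʳ 1# ⟨
      1# + 0#         ≈⟨ +-congˡ (R.-‿inverseˡ t) ⟨
      1# + (- t + t)  ≈⟨ R.+-assoc 1# (- t) t ⟨
      (1# - t) + t    ≈⟨ R.+-comm _ t ⟩
      t + (1# - t)    ∎

    -- Only the summand at c changes, and 1 = t + (1 - t).
    threshold-suc : ∀ {n} (c : Fin n) (h : Fin n → Carrier) →
      ∑ (λ x → t ^ 𝟙 (toℕ x ℕ.<? toℕ c) * h x) ≈ ∑ (λ x → t ^ 𝟙 (toℕ x ℕ.<? suc (toℕ c)) * h x) + (1# - t) * h c
    threshold-suc {suc n} zero h = begin
      1# * h zero + rest                             ≈⟨ +-congʳ (*-congʳ 1≈t+[1-t]) ⟩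
      (t + (1# - t)) * h zero + rest                 ≈⟨ solve 4 (λ t d h r → (t :+ d) :* h :+ r := (t :* h :+ r) :+ d :* h) R.refl
                                                          t (1# - t) (h zero) rest ⟩
      (t * h zero + rest) + (1# - t) * h zero        ≈⟨ +-congʳ (+-congʳ (*-congʳ (R.*-identityʳ t))) ⟨
      (t ^ 1 * h zero + rest) + (1# - t) * h zero    ∎
      where
      -- The later letters lie below neither threshold 0 nor threshold 1, so their power of `t` is 1
      -- on both sides.
      rest = ∑ (λ (x : Fin n) → 1# * h (suc x))
    threshold-suc {suc n} (suc c) h = begin
      t ^ 1 * h zero + ∑ (λ x → t ^ 𝟙 (toℕ x ℕ.<? toℕ c) * h (suc x))  ≈⟨ +-congˡ (threshold-suc c (h ∘ suc)) ⟩
      t ^ 1 * h zero + (_ + (1# - t) * h (suc c))                      ≈⟨ R.+-assoc _ _ _ ⟨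
      (t ^ 1 * h zero + _) + (1# - t) * h (suc c)                      ∎

    Q-threshold : ∀ {n c} → c ≤ n → Q (suc n) c ≈ Q (suc n) (suc c) + (1# - t) * Q n c
    Q-threshold {n} {c} c≤n = begin
      Q (suc n) c                                  ≈⟨ Q-suc n c ⟩
      summed c                                     ≡⟨ cong summed (toℕ-fromℕ< (s≤s c≤n)) ⟨
      summed (toℕ x)                               ≈⟨ threshold-suc x (λ x → Q n (toℕ x)) ⟩
      summed (suc (toℕ x)) + (1# - t) * Q n (toℕ x) ≡⟨ cong (λ c → summed (suc c) + (1# - t) * Q n c) (toℕ-fromℕ< (s≤s c≤n)) ⟩
      summed (suc c) + (1# - t) * Q n c            ≈⟨ +-congʳ (Q-suc n (suc c)) ⟨
      Q (suc n) (suc c) + (1# - t) * Q n c         ∎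
      where
      x : Fin (suc n)
      -- The bound `c ≤ n` makes `c` a possible first letter.
      x = fromℕ< (s≤s c≤n)
      summed : ℕ → Carrier
      summed c = ∑[ x < suc n ] (t ^ 𝟙 (toℕ x ℕ.<? c) * Q n (toℕ x))

    -- The signs fix the alphabet, so one bijection `ρ` standardizes the words of all `τ` at once
    -- and merely permutes `𝔖 n`.
    sumOver-letters : ∀ {n} (ε : Vec (Fin 2) n) →
      sumOver (𝔖 n) (λ τ → t ^ desFrom n (toℕ ∘ letters ε ∘ lookup τ)) ≈ Q n (sum (toℕ ∘ lookup ε))
    sumOver-letters {n} ε = begin
      sumOver (𝔖 n) (λ τ → t ^ desFrom n (l ∘ lookup τ))
        ≈⟨ sumOver-cong (𝔖 n) (λ {τ} _ → ^-congʳ t (desFrom-ρ n τ)) ⟩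
      sumOver (𝔖 n) (λ τ → t ^ desFrom (rank n) (toℕ ∘ lookup (Vec.map ρ τ)))
        ≈⟨ sumOver-𝔖-map ρ-injective (λ σ → t ^ desFrom (rank n) (toℕ ∘ lookup σ)) ⟨
      Q n (rank n)
        -- The rank of zero is the number of negative letters.
        ≡⟨ cong (Q n) (sum-cong-≗ λ a → letter-sign (lookup ε a) a) ⟩
      Q n (sum (toℕ ∘ lookup ε)) ∎
      where
      l : Fin n → ℕ
      l = toℕ ∘ letters ε
      open Standardization l (λ {a} {b} eq → proj₂ (letter-injective (lookup ε a) (lookup ε b) (toℕ-injective eq)))

    -- Sums over sign words.

    module _ (y : Carrier) where

      -- Equal to the sum of `(n C q) y^q f(q)` over `q`; summing over words instead lets the first
      -- sign be split off.
      signSum : ∀ n → (ℕ → Carrier) → Carrier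
      signSum n f = sumOver (words 2 n) λ ε → y ^ sum (toℕ ∘ lookup ε) * f (sum (toℕ ∘ lookup ε))

      -- The power of `y` depends on the signs alone and leaves the sum over `τ`, which
      -- `sumOver-letters` evaluates.
      B-suc≈signSum : ∀ n → B (suc n) y t ≈ signSum (suc n) (Q (suc n))
      B-suc≈signSum m = R.trans (sumOver-𝔅 n (λ π → y ^ neg {n} π * t ^ desB {n} π)) (sumOver-cong (words 2 n) λ {ε} _ → begin
        sumOver (𝔖 n) (λ τ → y ^ neg {n} (assemble (ε , τ)) * t ^ desB {n} (assemble (ε , τ)))
          ≈⟨ sumOver-cong (𝔖 n) (λ {τ} τ∈ → *-cong (^-congʳ y (neg-assemble ε τ (∈-𝔖⁻ τ∈))) (^-congʳ t (desB-assemble ε τ))) ⟩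
        sumOver (𝔖 n) (λ τ → y ^ sum (toℕ ∘ lookup ε) * t ^ desFrom n (toℕ ∘ letters ε ∘ lookup τ))
          ≈⟨ sumOver-* _ (𝔖 n) ⟩
        y ^ sum (toℕ ∘ lookup ε) * sumOver (𝔖 n) (λ τ → t ^ desFrom n (toℕ ∘ letters ε ∘ lookup τ))
          ≈⟨ *-congˡ (sumOver-letters ε) ⟩
        y ^ sum (toℕ ∘ lookup ε) * Q n (sum (toℕ ∘ lookup ε)) ∎)
        where
        n = suc m

      signs≤n : ∀ {n} (ε : Vec (Fin 2) n) → sum (toℕ ∘ lookup ε) ≤ n
      signs≤n {n} ε = subst (sum (toℕ ∘ lookup ε) ≤_) (sum-ones n) (sum-mono-≤ λ i → ℕ.s≤s⁻¹ (toℕ<n (lookup ε i)))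

      -- A word of `n` signs has at most `n` minus signs; `Q-threshold` is available in just this
      -- range.
      signSum-cong : ∀ n f g → (∀ k → k ≤ n → f k ≈ g k) → signSum n f ≈ signSum n g
      signSum-cong n f g f≈g = sumOver-cong (words 2 n) λ {ε} _ → *-congˡ (f≈g _ (signs≤n ε))

      signSum-linear : ∀ n c f g → signSum n (λ k → f k + c * g k) ≈ signSum n f + c * signSum n g
      signSum-linear n c f g = begin
        signSum n (λ k → f k + c * g k)
          ≈⟨ sumOver-cong (words 2 n) (λ _ → solve 4 (λ p f c g → p :* (f :+ c :* g) := p :* f :+ c :* (p :* g)) R.refl _ _ c _) ⟩
        sumOver (words 2 n) (λ ε → y ^ sum (toℕ ∘ lookup ε) * f _ + c * (y ^ sum (toℕ ∘ lookup ε) * g _))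
          ≈⟨ sumOver-+ (words 2 n) ⟩
        signSum n f + sumOver (words 2 n) (λ ε → c * (y ^ sum (toℕ ∘ lookup ε) * g _))
          ≈⟨ +-congˡ (sumOver-* c (words 2 n)) ⟩
        signSum n f + c * signSum n g ∎

      signSum-suc : ∀ n f → signSum (suc n) f ≈ signSum n f + y * signSum n (f ∘ suc)
      signSum-suc n f = begin
        signSum (suc n) f
          ≈⟨ sumOver-cartesianProductWith _∷_ (List.allFin 2) (words 2 n)
               (λ ε → y ^ sum (toℕ ∘ lookup ε) * f (sum (toℕ ∘ lookup ε))) ⟩
        signSum n f + (sumOver (words 2 n) (λ ε → y ^ suc (sum (toℕ ∘ lookup ε)) * f (suc (sum (toℕ ∘ lookup ε)))) + 0#)
          ≈⟨ +-congˡ (R.+-identityʳ _) ⟩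
        signSum n f + sumOver (words 2 n) (λ ε → y ^ suc (sum (toℕ ∘ lookup ε)) * f (suc (sum (toℕ ∘ lookup ε))))
          ≈⟨ +-congˡ (R.trans (sumOver-cong (words 2 n) λ _ → R.*-assoc y _ _) (sumOver-* y (words 2 n))) ⟩
        signSum n f + y * signSum n (f ∘ suc) ∎

      -- A first sign minus turns the threshold into `q + k + 1` and gives `y` times the sum of `f`.
      -- A first sign plus keeps `q + k`, and `Q-threshold` raises it to the same `f` at the cost of
      -- `1 - t` times `g`.
      signSum-Q-suc : ∀ n q → signSum (suc n) (λ k → Q (q ℕ.+ suc n) (q ℕ.+ k)) ≈
        (1# + y) * signSum n (λ k → Q (suc q ℕ.+ n) (suc q ℕ.+ k)) + (1# - t) * signSum n (λ k → Q (q ℕ.+ n) (q ℕ.+ k))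
      signSum-Q-suc n q rewrite ℕ.+-suc q n = begin
        signSum (suc n) (λ k → Q (suc q ℕ.+ n) (q ℕ.+ k))
          ≈⟨ signSum-suc n (λ k → Q (suc q ℕ.+ n) (q ℕ.+ k)) ⟩
        signSum n (λ k → Q (suc q ℕ.+ n) (q ℕ.+ k)) + y * signSum n (λ k → Q (suc q ℕ.+ n) (q ℕ.+ suc k))
          ≈⟨ +-cong (signSum-cong n _ (λ k → f k + (1# - t) * g k) (λ k k≤n → Q-threshold (ℕ.+-monoʳ-≤ q k≤n)))
               (*-congˡ (signSum-cong n _ f λ k _ → R.reflexive (cong (Q (suc q ℕ.+ n)) (ℕ.+-suc q k)))) ⟩
        signSum n (λ k → f k + (1# - t) * g k) + y * signSum n f
          ≈⟨ +-congʳ (signSum-linear n (1# - t) f g) ⟩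
        (signSum n f + (1# - t) * signSum n g) + y * signSum n f
          ≈⟨ +-congʳ (+-congʳ (R.*-identityˡ (signSum n f))) ⟨
        (1# * signSum n f + (1# - t) * signSum n g) + y * signSum n f
          ≈⟨ solve 5 (λ o s d t y → (o :* s :+ d :* t) :+ y :* s := (o :+ y) :* s :+ d :* t) R.refl
               1# (signSum n f) (1# - t) (signSum n g) y ⟩
        (1# + y) * signSum n f + (1# - t) * signSum n g ∎
        where
        f g : ℕ → Carrier
        f k = Q (suc q ℕ.+ n) (suc q ℕ.+ k)
        g k = Q (q ℕ.+ n) (q ℕ.+ k)

  -- Binomial sums and Pascal's rule.

  module _ (u v : Carrier) where

    binomialTerm : ℕ → (ℕ → Carrier) → ℕ → Carrier
    binomialTerm n g k = (n C k) × (u ^ k * v ^ (n ∸ k) * g k)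

    binomialSum : ℕ → (ℕ → Carrier) → Carrier
    binomialSum n g = ∑[ k ≤ n ] binomialTerm n g (toℕ k)

    binomialSum-cong : ∀ n f g → (∀ k → f k ≈ g k) → binomialSum n f ≈ binomialSum n g
    binomialSum-cong n f g f≈g = sum-cong-≋ {x = binomialTerm n f ∘ toℕ {suc n}} {y = binomialTerm n g ∘ toℕ} λ k →
      ×-congʳ (n C toℕ k) (*-congˡ (f≈g (toℕ k)))

    binomialSum-suc : ∀ n g → binomialSum (suc n) g ≈ u * binomialSum n (g ∘ suc) + v * binomialSum n g
    binomialSum-suc n g = begin
      -- The summand at 0 is already `term 0`, since `suc n C 0` and `n C 0` agree; Pascal's rule
      -- splits the others.
      term 0 + ∑[ k ≤ n ] ((suc n C suc (toℕ k)) × x (suc (toℕ k)))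
        ≈⟨ +-congˡ (sum-cong-≋ {n = suc n} λ k → R.trans
             (×-congˡ {x (suc (toℕ k))} (sym (nCk+nC[k+1]≡[n+1]C[k+1] n (toℕ k))))
             (×-homo-+ (x (suc (toℕ k))) (n C toℕ k) (n C suc (toℕ k)))) ⟩
      term 0 + ∑[ k ≤ n ] ((n C toℕ k) × x (suc (toℕ k)) + term (suc (toℕ k)))
        ≈⟨ +-congˡ (∑-distrib-+ {n = suc n} (λ k → (n C toℕ k) × x (suc (toℕ k))) (term ∘ suc ∘ toℕ)) ⟩
      term 0 + (∑[ k ≤ n ] ((n C toℕ k) × x (suc (toℕ k))) + ∑[ k ≤ n ] term (suc (toℕ k)))
        ≈⟨ solve 3 (λ a b c → a :+ (b :+ c) := b :+ (a :+ c)) R.refl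
             (term 0) (∑[ k ≤ n ] ((n C toℕ k) × x (suc (toℕ k)))) (∑[ k ≤ n ] term (suc (toℕ k))) ⟩
      ∑[ k ≤ n ] ((n C toℕ k) × x (suc (toℕ k))) + ∑[ k ≤ suc n ] term (toℕ k)
        ≈⟨ +-cong taken skipped ⟩
      u * binomialSum n (g ∘ suc) + v * binomialSum n g ∎
      where
      x : ℕ → Carrier
      x k = u ^ k * v ^ (suc n ∸ k) * g k

      term : ℕ → Carrier
      term k = (n C k) × x k

      taken : ∑[ k ≤ n ] ((n C toℕ k) × x (suc (toℕ k))) ≈ u * binomialSum n (g ∘ suc)
      taken = begin
        ∑[ k ≤ n ] ((n C toℕ k) × x (suc (toℕ k)))
          ≈⟨ sum-cong-≋ {n = suc n} (λ k → R.trans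
               (×-congʳ (n C toℕ k) (solve 4 (λ u a b c → (u :* a) :* b :* c := u :* (a :* b :* c)) R.refl
                 u (u ^ toℕ k) (v ^ (n ∸ toℕ k)) (g (suc (toℕ k)))))
               (R.sym (×-comm-* (n C toℕ k) u _))) ⟩
        ∑[ k ≤ n ] (u * binomialTerm n (g ∘ suc) (toℕ k))
          ≈⟨ *-distribˡ-sum {n = suc n} u (binomialTerm n (g ∘ suc) ∘ toℕ) ⟨
        u * binomialSum n (g ∘ suc) ∎

      skipped : ∑[ k ≤ suc n ] term (toℕ k) ≈ v * binomialSum n g
      skipped = begin
        ∑[ k ≤ suc n ] term (toℕ k)
          ≈⟨ sum-init-last {n = suc n} (term ∘ toℕ) ⟩
        -- The last summand vanishes because `n C suc n` is 0.
        ∑[ k ≤ n ] term (toℕ (inject₁ k)) + term (toℕ (Fin.fromℕ (suc n)))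
          ≈⟨ +-cong (sum-cong-≋ {n = suc n} below) (×-congˡ (k>n⇒nCk≡0 (ℕ.≤-reflexive (sym (toℕ-fromℕ (suc n)))))) ⟩
        ∑[ k ≤ n ] (v * binomialTerm n g (toℕ k)) + 0#
          ≈⟨ R.+-identityʳ _ ⟩
        ∑[ k ≤ n ] (v * binomialTerm n g (toℕ k))
          ≈⟨ *-distribˡ-sum {n = suc n} v (binomialTerm n g ∘ toℕ) ⟨
        v * binomialSum n g ∎
        where
        below : ∀ (k : Fin (suc n)) → term (toℕ (inject₁ k)) ≈ v * binomialTerm n g (toℕ k)
        -- As `k ≤ n`, the truncated `suc n ∸ k` equals `suc (n ∸ k)`, which releases a factor `v`.
        below k rewrite toℕ-inject₁ k | ℕ.+-∸-assoc 1 (ℕ.s≤s⁻¹ (toℕ<n k)) = R.trans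
          (×-congʳ (n C toℕ k) (solve 4 (λ v a b c → a :* (v :* b) :* c := v :* (a :* b :* c)) R.refl
            v (u ^ toℕ k) (v ^ (n ∸ toℕ k)) (g (toℕ k))))
          (R.sym (×-comm-* (n C toℕ k) v _))

  -- Induction on the number of signs, and the identity.

  -- The shift q makes the induction go through; the case of interest is q = 0.
  signSum-Q : ∀ t y n q → signSum t y n (λ k → Q t (q ℕ.+ n) (q ℕ.+ k)) ≈
                          binomialSum (1# + y) (1# - t) n (λ k → Q t (q ℕ.+ k) (q ℕ.+ k))
  signSum-Q t y zero    q = +-congʳ (begin
    1# * Q t (q ℕ.+ 0) (q ℕ.+ 0)             ≈⟨ *-congʳ (R.*-identityˡ 1#) ⟨
    1# * 1# * Q t (q ℕ.+ 0) (q ℕ.+ 0)        ≈⟨ R.+-identityʳ _ ⟨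
    1# * 1# * Q t (q ℕ.+ 0) (q ℕ.+ 0) + 0#   ∎)
  signSum-Q t y (suc n) q = begin
    signSum t y (suc n) (λ k → Q t (q ℕ.+ suc n) (q ℕ.+ k))
      ≈⟨ signSum-Q-suc t y n q ⟩
    (1# + y) * signSum t y n (λ k → Q t (suc q ℕ.+ n) (suc q ℕ.+ k))
      + (1# - t) * signSum t y n (λ k → Q t (q ℕ.+ n) (q ℕ.+ k))
      ≈⟨ +-cong (*-congˡ (signSum-Q t y n (suc q))) (*-congˡ (signSum-Q t y n q)) ⟩
    (1# + y) * binomialSum (1# + y) (1# - t) n (λ k → Q t (suc q ℕ.+ k) (suc q ℕ.+ k))
      + (1# - t) * binomialSum (1# + y) (1# - t) n g
      ≈⟨ +-congʳ (*-congˡ (binomialSum-cong _ _ n _ (g ∘ suc) λ k → R.reflexive (cong (λ m → Q t m m) (sym (ℕ.+-suc q k))))) ⟩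
    (1# + y) * binomialSum (1# + y) (1# - t) n (g ∘ suc) + (1# - t) * binomialSum (1# + y) (1# - t) n g
      ≈⟨ binomialSum-suc _ _ n g ⟨
    binomialSum (1# + y) (1# - t) (suc n) g ∎
    where
    g : ℕ → Carrier
    g k = Q t (q ℕ.+ k) (q ℕ.+ k)

  -- `B` is set to 1 at 0; there the right-hand side has a single summand 1, from the empty sign
  -- word and the empty permutation.
  B≈signSum : ∀ n y t → B n y t ≈ signSum t y n (Q t n)
  B≈signSum zero    y t = R.sym (R.trans (R.+-identityʳ _) (R.trans (R.*-identityˡ _) (R.+-identityʳ _)))
  B≈signSum (suc n) y t = B-suc≈signSum t y n

  B≈binomialSum : ∀ n y t → B n y t ≈ binomialSum (1# + y) (1# - t) n (λ k → A k t)
  B≈binomialSum n y t = begin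
    B n y t                                            ≈⟨ B≈signSum n y t ⟩
    signSum t y n (Q t n)                              ≈⟨ signSum-Q t y n 0 ⟩
    binomialSum (1# + y) (1# - t) n (λ k → Q t k k)    ≈⟨ binomialSum-cong _ _ n (λ k → A k t) (λ k → Q t k k) (A≈Q t) ⟨
    binomialSum (1# + y) (1# - t) n (λ k → A k t)      ∎

theorem2p6 : ∀ {a ℓ} (R : CommutativeRing a ℓ) →
  let open CommutativeRing R
      open Algebra.Properties.Semiring.Exp semiring using (_^_)
      open Algebra.Properties.Semiring.Mult semiring using (_×_)
      open Algebra.Properties.Semiring.Sum semiring using (sum⁺-syntax)
      open EulerianPolynomials R
  in
  ∀ (n : ℕ) (y t : Carrier) →
  B n y t ≈ ∑[ k ≤ n ] ((n C toℕ k) × ((1# + y) ^ toℕ k * (1# - t) ^ (n ∸ toℕ k) * A (toℕ k) t))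
theorem2p6 R = Evaluation.B≈binomialSum R
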